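{- There is an absolute constant $C>0$ such that for all integers $k\ge 1$ and $n\ge 2$, the semiring complexity of the complete homogeneous symmetric polynomial $$h_n(x_1,\dots,x_k)=\sum_{1\le i_1\le\cdots\le i_n\le k}x_{i_1}\cdots x_{i_n}$$ is at most $C\,k^2\log(n)$.
   Context: Semiring complexity: for a polynomial $f(x_1,\dots,x_k)$ with nonnegative integer coefficients, the semiring complexity of $f$ is the smallest number of gates in an arithmetic circuit in which each gate performs a (binary) addition or multiplication, whose inputs are $x_1,\dots,x_k$ together with any positive integer scalars, and whose output is $f(x_1,\dots,x_k)$. Subtraction and division are not allowed; gates may have arbitrary fan-out. -}

module Defs where

open import Data.Fin using (Fin)
import Data.Fin as Fin
open import Data.List using (List; []; _∷_; _++_; [_]; map; filter; foldr; allFin; cartesianProductWith)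
open import Data.Nat using (ℕ; zero; suc; _+_; _*_; _≤_; NonZero)
open import Data.Nat.ListAction using (sum)
open import Data.Nat.Properties using (≤-trans)
import Data.Nat as ℕ
open import Data.Product using (_×_; _,_; proj₁; proj₂; ∃-syntax)
open import Data.Vec as Vec using (Vec; []; _∷_)
open import Data.Vec.Properties using (≡-dec)
open import Data.Vec.Relation.Unary.Linked using (Linked; linked?)
open import Function.Bundles using (_⇔_; mk⇔)
open import Relation.Binary.PropositionalEquality using (_≡_)

-- Polynomials in k variables over ℕ, as finite formal sums of terms c·xᵉ.
-- The same exponent may occur several times and c may be 0, so equality of
-- polynomials is _≈_ below (equality of all coefficients), not _≡_.

Exponent : ℕ → Set
Exponent k = Vec ℕ k

Poly : ℕ → Set
Poly k = List (ℕ × Exponent k)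

coeff : ∀ {k} → Poly k → Exponent k → ℕ
coeff p e = sum (map proj₁ (filter (λ t → ≡-dec ℕ._≟_ (proj₂ t) e) p))

infix 4 _≈_
_≈_ : ∀ {k} → Poly k → Poly k → Set
p ≈ q = ∀ e → coeff p e ≡ coeff q e

con : ∀ {k} → ℕ → Poly k
con {k} c = [ c , Vec.replicate k 0 ]

var : ∀ {k} → Fin k → Poly k
var {k} i = [ 1 , (Vec.replicate k 0 Vec.[ i ]≔ 1) ]

infixl 6 _⊕_
infixl 7 _⊗_

_⊕_ : ∀ {k} → Poly k → Poly k → Poly k
_⊕_ = _++_

_⊗_ : ∀ {k} → Poly k → Poly k → Poly k
_⊗_ = cartesianProductWith λ (c , d) (c′ , d′) → c * c′ , Vec.zipWith _+_ d d′

∑ : ∀ {k} → List (Poly k) → Poly k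
∑ = foldr _⊕_ []

∏ : ∀ {k n} → Vec (Poly k) n → Poly k
∏ = Vec.foldr _ _⊗_ (con 1)

tuples : (k n : ℕ) → List (Vec (Fin k) n)
tuples k zero    = [ [] ]
tuples k (suc n) = cartesianProductWith _∷_ (allFin k) (tuples k n)

-- The index tuples i₁ ≤ ⋯ ≤ iₙ, each occurring exactly once.
weaklyIncreasing : (k n : ℕ) → List (Vec (Fin k) n)
weaklyIncreasing k n = filter (linked? Fin._≤?_) (tuples k n)

h : (n k : ℕ) → Poly k
h n k = ∑ (map (λ is → ∏ (Vec.map var is)) (weaklyIncreasing k n))

data Op : Set where
  add mul : Op

-- What a wire can carry when m gates have already been placed.
data Source (k m : ℕ) : Set where
  input  : Fin k → Source k m
  scalar : (c : ℕ) .{{_ : NonZero c}} → Source k m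
  gate   : Fin m → Source k m

record Gate (k m : ℕ) : Set where
  constructor mkGate
  field
    op          : Op
    left right  : Source k m

-- Gates k s is a sequence of s gates, each reading only from gates placed
-- before it; a gate can be read any number of times (arbitrary fan-out).
-- Gates are numbered backwards: gate zero is the one placed last.
infixl 5 _▷_
data Gates (k : ℕ) : ℕ → Set where
  []  : Gates k 0
  _▷_ : ∀ {m} → Gates k m → Gate k m → Gates k (suc m)

-- The output may also be taken directly from an input or a scalar, so that
-- these are computed by circuits with 0 gates.
record Circuit (k s : ℕ) : Set where
  constructor mkCircuit
  field
    gates  : Gates k s
    output : Source k s

⟦_⟧op : ∀ {k} → Op → Poly k → Poly k → Poly k
⟦ add ⟧op = _⊕_
⟦ mul ⟧op = _⊗_

⟦_⟧source : ∀ {k m} → Source k m → Vec (Poly k) m → Poly k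
⟦ input i  ⟧source vs = var i
⟦ scalar c ⟧source vs = con c
⟦ gate j   ⟧source vs = Vec.lookup vs j

⟦_⟧gates : ∀ {k s} → Gates k s → Vec (Poly k) s
⟦ []                ⟧gates = []
⟦ gs ▷ mkGate o l r ⟧gates = ⟦ o ⟧op (⟦ l ⟧source vs) (⟦ r ⟧source vs) ∷ vs
  where vs = ⟦ gs ⟧gates

⟦_⟧ : ∀ {k s} → Circuit k s → Poly k
⟦ mkCircuit gs o ⟧ = ⟦ o ⟧source ⟦ gs ⟧gates

ComputableWith : ∀ {k} → Poly k → ℕ → Set
ComputableWith {k} f s = ∃[ c ] (⟦_⟧ {k} {s} c ≈ f)

IsSemiringComplexity : ∀ {k} → Poly k → ℕ → Set
IsSemiringComplexity f s = ComputableWith f s × (∀ t → ComputableWith f t → s ≤ t)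

-- "The semiring complexity of f is at most B": the minimum of a set of
-- naturals is at most B exactly when some member of the set is.
SemiringComplexity≤ : ∀ {k} → Poly k → ℕ → Set
SemiringComplexity≤ f B = ∃[ s ] (s ≤ B × ComputableWith f s)

SemiringComplexity≤⇔ : ∀ {k} {f : Poly k} {s} → IsSemiringComplexity f s →
                       ∀ B → SemiringComplexity≤ f B ⇔ s ≤ B
SemiringComplexity≤⇔ {s = s} (attained , least) B = mk⇔
  (λ (t , t≤B , c) → ≤-trans (least t c) t≤B)
  (λ s≤B → s , s≤B , attained)

{-# OPTIONS --safe #-}
module Submission where

open import Defs
open import Data.Nat using (ℕ; _*_; _^_; _≤_; _<_)
open import Data.Nat.Logarithm using (⌊log₂_⌋)
open import Data.Product using (_×_; ∃-syntax)

open import Algebra.Bundles using (CommutativeSemiring)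
import Algebra.Solver.Ring.NaturalCoefficients.Default as NaturalCoefficientsSolver
open import Algebra.Structures.Biased using (IsCommutativeSemiringˡ)
open import Data.Bool using (Bool; true; false; if_then_else_; _∧_)
open import Data.Empty using (⊥-elim)
open import Data.Fin as Fin using (Fin; zero; suc)
open import Data.List using (List; []; _∷_; _++_; map; filter; allFin; tabulate; cartesianProductWith; length)
open import Data.List.Properties using (++-assoc; map-tabulate; map-∘; length-map; length-tabulate)
open import Data.List.Relation.Unary.All as All using (All; []; _∷_)
open import Data.List.Relation.Unary.All.Properties using (tabulate⁺)
open import Data.Nat as ℕ using (zero; suc; _+_; ⌊_/2⌋; ⌈_/2⌉; z≤n; s≤s; z<s; s<s)
open import Data.Nat.Logarithm using (⌊log₂⌋-mono-≤; ⌊log₂[2^n]⌋≡n)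
open import Data.Nat.Properties
open import Algebra.Properties.CommutativeSemigroup +-commutativeSemigroup using (interchange)
open import Algebra.Properties.CommutativeSemigroup *-commutativeSemigroup using (x∙yz≈y∙xz)
open import Data.Nat.Tactic.RingSolver using (solve-∀)
open import Data.Product using (_,_; Σ-syntax; proj₁; proj₂)
open import Data.Sum using (_⊎_; inj₁; inj₂)
open import Data.Vec as Vec using (Vec; []; _∷_)
open import Data.Vec.Properties using (≡-dec; zipWith-assoc; zipWith-comm; zipWith-identityˡ)
open import Data.Vec.Relation.Unary.Linked using (linked?)
open import Function using (_∘_; id)
open import Function.Bundles using (mk⇔)
open import Relation.Binary.PropositionalEquality using (_≡_; refl; sym; trans; cong; cong₂; subst; module ≡-Reasoning)
import Relation.Binary.Reasoning.Setoid as SetoidReasoning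
open import Relation.Binary.Structures using (IsEquivalence)
open import Relation.Nullary using (¬_; does)
open import Relation.Nullary.Decidable using (does-⇔)
open import Relation.Unary using (Pred; Decidable)

-- From 1/(1 − xt) = (1 + xt)/(1 − x²t²), taking products over the variables,
-- ∑ hₙ(x) tⁿ = ∏(1 + xᵢt) · ∑ hₘ(x²) t²ᵐ.  Hence the k consecutive values
-- h_N, …, h_{N−k+1} at x are obtained from the k values h_M, …, h_{M−k+1} at x²,
-- M = ⌊N/2⌋: interleaving the latter with zeros gives 2k consecutive
-- coefficients of the second factor, and each of the k multiplications by
-- 1 + xᵢt uses up one of them.  Such a step costs O(k²) gates, and after
-- 1 + ⌊log₂ n⌋ steps only h₀ = 1 and zeros remain.

-- Power series over a commutative semiring

module GeneratingSeries {c ℓ} (R : CommutativeSemiring c ℓ) where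

  open CommutativeSemiring R using (Carrier; 0#; 1#; setoid)
    renaming ( _+_ to _+ᴿ_; _*_ to _*ᴿ_; _≈_ to _≈ᴿ_; refl to ≈-refl; sym to ≈-sym; trans to ≈-trans
             ; +-cong to +ᴿ-cong; +-congˡ to +ᴿ-congˡ; *-congˡ to *ᴿ-congˡ
             ; +-identityˡ to +ᴿ-identityˡ; +-identityʳ to +ᴿ-identityʳ; zeroʳ to *ᴿ-zeroʳ )
  open NaturalCoefficientsSolver R using (solve; _:=_; _:+_; _:*_)
  open SetoidReasoning setoid

  Series : Set c
  Series = ℕ → Carrier

  -- Multiplication by `t`.
  shift : Series → Series
  shift f zero    = 0#
  shift f (suc n) = f n

  infix 4 _≋_
  _≋_ : Series → Series → Set ℓ
  f ≋ g = ∀ n → f n ≈ᴿ g n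

  -- The coefficients of `∏ 1/(1 − xt)`, that is, the complete homogeneous polynomials. The last
  -- clause separates the monomials that contain `x` from those that do not.
  complete : List Carrier → Series
  complete []       zero    = 1#
  complete []       (suc n) = 0#
  complete (x ∷ xs) zero    = 1#
  complete (x ∷ xs) (suc n) = x *ᴿ complete (x ∷ xs) n +ᴿ complete xs (suc n)

  complete-zero : ∀ xs → complete xs 0 ≈ᴿ 1#
  complete-zero []       = ≈-refl
  complete-zero (x ∷ xs) = ≈-refl

  -- f + x t g
  mulAdd : Carrier → Series → Series → Series
  mulAdd x f g n = f n +ᴿ x *ᴿ shift g n

  shift-cong : ∀ {f g} → f ≋ g → shift f ≋ shift g
  shift-cong f≋g zero    = ≈-refl
  shift-cong f≋g (suc n) = f≋g n

  mulAdd-cong : ∀ {x f f′ g g′} → f ≋ f′ → g ≋ g′ → mulAdd x f g ≋ mulAdd x f′ g′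
  mulAdd-cong f≋f′ g≋g′ n = +ᴿ-cong (f≋f′ n) (*ᴿ-congˡ (shift-cong g≋g′ n))

  linear : Carrier → Series → Series
  linear x f = mulAdd x f f

  -- Multiplication by `∏ (1 + xt)`. The factors are applied from the head of the list on, which is
  -- the order in which the circuit will apply them.
  linears : List Carrier → Series → Series
  linears []       f = f
  linears (x ∷ xs) f = linears xs (linear x f)

  linears-cong : ∀ xs {f g} → f ≋ g → linears xs f ≋ linears xs g
  linears-cong []       f≋g = f≋g
  linears-cong (x ∷ xs) f≋g = linears-cong xs (mulAdd-cong f≋g f≋g)

  linear-shift : ∀ x f → linear x (shift f) ≋ shift (linear x f)
  linear-shift x f zero    = ≈-trans (+ᴿ-identityˡ _) (*ᴿ-zeroʳ x)
  linear-shift x f (suc n) = ≈-refl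

  linears-shift : ∀ xs f → linears xs (shift f) ≋ shift (linears xs f)
  linears-shift []       f n = ≈-refl
  linears-shift (x ∷ xs) f n =
    ≈-trans (linears-cong xs (linear-shift x f) n) (linears-shift xs (linear x f) n)

  linear-mulAdd : ∀ x y f g → linear x (mulAdd y f g) ≋ mulAdd y (linear x f) (linear x g)
  linear-mulAdd x y f g zero =
    solve 4 (λ x y f z → (f :+ y :* z) :+ x :* z := (f :+ x :* z) :+ y :* z) ≈-refl x y (f 0) 0#
  linear-mulAdd x y f g (suc n) =
    solve 6 (λ x y f₁ f₀ g₁ g₀ → (f₁ :+ y :* g₁) :+ x :* (f₀ :+ y :* g₀) := (f₁ :+ x :* f₀) :+ y :* (g₁ :+ x :* g₀))
      ≈-refl x y (f (suc n)) (f n) (g n) (shift g n)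

  -- Multiplications of series commute and distribute over sums. This lets both `1 + xt` and the
  -- term in `x²t²` be moved outside the product over the remaining variables.
  linears-mulAdd : ∀ xs y f g → linears xs (mulAdd y f g) ≋ mulAdd y (linears xs f) (linears xs g)
  linears-mulAdd []       y f g n = ≈-refl
  linears-mulAdd (x ∷ xs) y f g n =
    ≈-trans (linears-cong xs (linear-mulAdd x y f g) n) (linears-mulAdd xs y (linear x f) (linear x g) n)

  -- f(t²)
  spread : Series → Series
  spread f zero          = f 0
  spread f (suc zero)    = 0#
  spread f (suc (suc n)) = spread (f ∘ suc) n

  spread-zero : ∀ n → spread (λ _ → 0#) n ≈ᴿ 0#
  spread-zero zero          = ≈-refl
  spread-zero (suc zero)    = ≈-refl
  spread-zero (suc (suc n)) = spread-zero n

  spread-combination : ∀ y f g → spread (λ m → y *ᴿ f m +ᴿ g m) ≋ λ n → spread g n +ᴿ y *ᴿ spread f n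
  spread-combination y f g zero          = solve 3 (λ y f g → y :* f :+ g := g :+ y :* f) ≈-refl y (f 0) (g 0)
  spread-combination y f g (suc zero)    = ≈-sym (≈-trans (+ᴿ-identityˡ _) (*ᴿ-zeroʳ y))
  spread-combination y f g (suc (suc n)) = spread-combination y (f ∘ suc) (g ∘ suc) n

  square : Carrier → Carrier
  square x = x *ᴿ x

  -- The recursion of `complete` with `t²` in place of `t`; the double shift is multiplication by
  -- `t²`.
  spread-complete-∷ : ∀ y ys → let g = spread (complete (y ∷ ys)) in
                      g ≋ λ n → spread (complete ys) n +ᴿ y *ᴿ shift (shift g) n
  spread-complete-∷ y ys zero =
    ≈-sym (≈-trans (+ᴿ-congˡ (*ᴿ-zeroʳ y)) (≈-trans (+ᴿ-identityʳ _) (complete-zero ys)))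
  spread-complete-∷ y ys (suc zero)    = ≈-sym (≈-trans (+ᴿ-identityˡ _) (*ᴿ-zeroʳ y))
  spread-complete-∷ y ys (suc (suc n)) =
    spread-combination y (complete (y ∷ ys)) (complete ys ∘ suc) n

  -- 1/(1 − xt) = (1 + xt)/(1 − x²t²), with denominators cleared: the left-hand
  -- side is the only series g with g = complete xs + x t g.
  complete-doubling : ∀ xs → complete xs ≋ linears xs (spread (complete (map square xs)))
  complete-doubling []       zero          = ≈-refl
  complete-doubling []       (suc zero)    = ≈-refl
  complete-doubling []       (suc (suc n)) = ≈-sym (spread-zero n)
  complete-doubling (x ∷ xs) = unique
    where
    g f r : Series
    g = spread (complete (map square (x ∷ xs)))
    f = linears xs g
    r = linears xs (linear x g)

    r≋ : r ≋ linear x f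
    r≋ = linears-mulAdd xs x g g

    -- `(1 − x²t²) f = complete xs` without subtraction: the recursion for `g` is pushed through
    -- `linears xs`, and the induction hypothesis recognises `complete xs`.
    f≋ : ∀ n → f n ≈ᴿ complete xs n +ᴿ square x *ᴿ shift (shift f) n
    f≋ n = begin
      f n
        ≈⟨ linears-cong xs g≋ n ⟩
      linears xs (mulAdd (square x) (spread (complete (map square xs))) (shift g)) n
        ≈⟨ linears-mulAdd xs (square x) _ (shift g) n ⟩
      mulAdd (square x) (linears xs (spread (complete (map square xs)))) (linears xs (shift g)) n
        ≈⟨ mulAdd-cong (λ m → ≈-sym (complete-doubling xs m)) (linears-shift xs g) n ⟩
      mulAdd (square x) (complete xs) (shift f) n ∎
      where
      g≋ : g ≋ mulAdd (square x) (spread (complete (map square xs))) (shift g)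
      g≋ = spread-complete-∷ (square x) (map square xs)

    unique : complete (x ∷ xs) ≋ r
    unique zero = ≈-sym (begin
      r 0                                                ≈⟨ r≋ 0 ⟩
      f 0 +ᴿ x *ᴿ 0#                                     ≈⟨ +ᴿ-cong (f≋ 0) (*ᴿ-zeroʳ x) ⟩
      (complete xs 0 +ᴿ square x *ᴿ 0#) +ᴿ 0#            ≈⟨ +ᴿ-identityʳ _ ⟩
      complete xs 0 +ᴿ square x *ᴿ 0#                    ≈⟨ +ᴿ-cong (complete-zero xs) (*ᴿ-zeroʳ _) ⟩
      1# +ᴿ 0#                                           ≈⟨ +ᴿ-identityʳ 1# ⟩
      1#                                                 ∎)
    -- Since `r = f + xtf` and `f = complete xs + x²t²f`, also `r = complete xs + xtr`, which is the
    -- recursion defining `complete (x ∷ xs)`.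
    unique (suc n) = begin
      x *ᴿ complete (x ∷ xs) n +ᴿ complete xs (suc n)
        ≈⟨ +ᴿ-cong (*ᴿ-congˡ (≈-trans (unique n) (r≋ n))) ≈-refl ⟩
      x *ᴿ (f n +ᴿ x *ᴿ shift f n) +ᴿ complete xs (suc n)
        ≈⟨ solve 4 (λ x a b c → x :* (a :+ x :* b) :+ c := (c :+ x :* x :* b) :+ x :* a)
             ≈-refl x (f n) (shift f n) (complete xs (suc n)) ⟩
      (complete xs (suc n) +ᴿ square x *ᴿ shift f n) +ᴿ x *ᴿ f n
        ≈⟨ +ᴿ-cong (f≋ (suc n)) ≈-refl ⟨
      f (suc n) +ᴿ x *ᴿ f n
        ≈⟨ r≋ (suc n) ⟨
      r (suc n) ∎

  -- Windows of consecutive coefficients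

  -- The coefficient of index N − i, taken to be 0# if i > N.
  below : Series → ℕ → ℕ → Carrier
  below f zero    N       = f N
  below f (suc i) zero    = 0#
  below f (suc i) (suc N) = below f i N

  below-cong : ∀ {f g} → f ≋ g → ∀ i N → below f i N ≈ᴿ below g i N
  below-cong f≋g zero    N       = f≋g N
  below-cong f≋g (suc i) zero    = ≈-refl
  below-cong f≋g (suc i) (suc N) = below-cong f≋g i N

  below-linear : ∀ x f i N → below (linear x f) i N ≈ᴿ below f i N +ᴿ x *ᴿ below f (suc i) N
  below-linear x f zero    zero    = ≈-refl
  below-linear x f zero    (suc N) = ≈-refl
  below-linear x f (suc i) zero    = ≈-sym (≈-trans (+ᴿ-identityˡ _) (*ᴿ-zeroʳ x))
  below-linear x f (suc i) (suc N) = below-linear x f i N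

  -- The equation `⌊ n /2⌋ ≡ ⌊ suc n /2⌋` records that `n` is even.
  spread-cases : ∀ f n → spread f n ≡ 0# ⊎ (spread f n ≡ f ⌊ n /2⌋ × ⌊ n /2⌋ ≡ ⌊ suc n /2⌋)
  spread-cases f zero          = inj₂ (refl , refl)
  spread-cases f (suc zero)    = inj₁ refl
  spread-cases f (suc (suc n)) with spread-cases (f ∘ suc) n
  ... | inj₁ eq         = inj₁ eq
  ... | inj₂ (eq , eq′) = inj₂ (eq , cong suc eq′)

  -- A nonzero entry requires `N − i` to be even. Then `i` and `N` have the same parity, so half the
  -- difference is the difference of the rounded halves. Thus `l + l` entries after spreading draw
  -- on only `l` entries before it.
  below-spread : ∀ f i N → below (spread f) i N ≡ 0# ⊎ below (spread f) i N ≡ below f ⌊ i /2⌋ ⌊ N /2⌋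
  below-spread f zero N with spread-cases f N
  ... | inj₁ eq       = inj₁ eq
  ... | inj₂ (eq , _) = inj₂ eq
  below-spread f (suc i)       zero          = inj₁ refl
  below-spread f (suc zero)    (suc zero)    = inj₂ refl
  below-spread f (suc zero)    (suc (suc N)) with spread-cases f (suc N)
  ... | inj₁ eq         = inj₁ eq
  ... | inj₂ (eq , eq′) = inj₂ (trans eq (cong f eq′))
  below-spread f (suc (suc i)) (suc zero)    = inj₁ refl
  below-spread f (suc (suc i)) (suc (suc N)) = below-spread f i N

-- Formal sums as a commutative semiring

-- The value at p of the linear functional taking the monomial of exponent d to φ d.
pairing : ∀ {k} → Poly k → (Exponent k → ℕ) → ℕ
pairing []            φ = 0
pairing ((c , d) ∷ p) φ = c * φ d + pairing p φ

-- Equality under all linear functionals: it implies _≈_, and is visibly a congruence for _⊗_.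
infix 4 _∼_
record _∼_ {k} (p q : Poly k) : Set where
  constructor mk∼
  field
    pairing-≡ : ∀ φ → pairing p φ ≡ pairing q φ

open _∼_

-- The functional that extracts the coefficient at `e`.
indicator : ∀ {k} → Exponent k → Exponent k → ℕ
indicator e d = if does (≡-dec ℕ._≟_ d e) then 1 else 0

coeff≡pairing : ∀ {k} (p : Poly k) e → coeff p e ≡ pairing p (indicator e)
coeff≡pairing []            e = refl
coeff≡pairing ((c , d) ∷ p) e with does (≡-dec ℕ._≟_ d e)
... | true  = cong₂ _+_ (sym (*-identityʳ c)) (coeff≡pairing p e)
... | false = trans (coeff≡pairing p e) (cong (_+ pairing p (indicator e)) (sym (*-zeroʳ c)))

∼⇒≈ : ∀ {k} {p q : Poly k} → p ∼ q → p ≈ q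
∼⇒≈ {p = p} {q} p∼q e = trans (coeff≡pairing p e) (trans (pairing-≡ p∼q (indicator e)) (sym (coeff≡pairing q e)))

pairing-cong : ∀ {k} (p : Poly k) {φ ψ} → (∀ d → φ d ≡ ψ d) → pairing p φ ≡ pairing p ψ
pairing-cong []            φ≗ψ = refl
pairing-cong ((c , d) ∷ p) φ≗ψ = cong₂ _+_ (cong (c *_) (φ≗ψ d)) (pairing-cong p φ≗ψ)

pairing-⊕ : ∀ {k} (p q : Poly k) φ → pairing (p ⊕ q) φ ≡ pairing p φ + pairing q φ
pairing-⊕ []            q φ = refl
pairing-⊕ ((c , d) ∷ p) q φ = trans (cong (c * φ d +_) (pairing-⊕ p q φ)) (sym (+-assoc (c * φ d) _ _))

pairing-zero : ∀ {k} (p : Poly k) → pairing p (λ _ → 0) ≡ 0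
pairing-zero []            = refl
pairing-zero ((c , d) ∷ p) = cong₂ _+_ (*-zeroʳ c) (pairing-zero p)

pairing-combination : ∀ {k} (p : Poly k) c φ ψ →
                      pairing p (λ d → c * φ d + ψ d) ≡ c * pairing p φ + pairing p ψ
pairing-combination []             c φ ψ = sym (trans (+-identityʳ _) (*-zeroʳ c))
pairing-combination ((c′ , d) ∷ p) c φ ψ = begin
  c′ * (c * φ d + ψ d) + pairing p _
    ≡⟨ cong₂ _+_ (*-distribˡ-+ c′ (c * φ d) (ψ d)) (pairing-combination p c φ ψ) ⟩
  (c′ * (c * φ d) + c′ * ψ d) + (c * pairing p φ + pairing p ψ)
    ≡⟨ interchange (c′ * (c * φ d)) _ _ _ ⟩
  (c′ * (c * φ d) + c * pairing p φ) + (c′ * ψ d + pairing p ψ)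
    ≡⟨ cong (λ x → (x + c * pairing p φ) + (c′ * ψ d + pairing p ψ)) (x∙yz≈y∙xz c′ c (φ d)) ⟩
  (c * (c′ * φ d) + c * pairing p φ) + (c′ * ψ d + pairing p ψ)
    ≡⟨ cong (_+ (c′ * ψ d + pairing p ψ)) (*-distribˡ-+ c (c′ * φ d) (pairing p φ)) ⟨
  c * (c′ * φ d + pairing p φ) + (c′ * ψ d + pairing p ψ) ∎
  where open ≡-Reasoning

-- Interchange of two finite sums; commutativity of the product rests on it.
pairing-swap : ∀ {k} (p q : Poly k) (φ : Exponent k → Exponent k → ℕ) →
               pairing p (λ d → pairing q (φ d)) ≡ pairing q (λ d′ → pairing p (λ d → φ d d′))
pairing-swap []            q φ = sym (pairing-zero q)
pairing-swap ((c , d) ∷ p) q φ = begin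
  c * pairing q (φ d) + pairing p (λ d → pairing q (φ d))
    ≡⟨ cong (c * pairing q (φ d) +_) (pairing-swap p q φ) ⟩
  c * pairing q (φ d) + pairing q (λ d′ → pairing p (λ d → φ d d′))
    ≡⟨ pairing-combination q c (φ d) _ ⟨
  pairing q (λ d′ → c * φ d d′ + pairing p (λ d → φ d d′)) ∎
  where open ≡-Reasoning

infixl 6 _∙_
_∙_ : ∀ {k} → Exponent k → Exponent k → Exponent k
_∙_ = Vec.zipWith _+_

pairing-map : ∀ {k} c d (q : Poly k) φ →
              pairing (map (λ (c′ , d′) → c * c′ , d ∙ d′) q) φ ≡ c * pairing q (λ d′ → φ (d ∙ d′))
pairing-map c d []              φ = sym (*-zeroʳ c)
pairing-map c d ((c′ , d′) ∷ q) φ =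
  trans (cong₂ _+_ (*-assoc c c′ _) (pairing-map c d q φ)) (sym (*-distribˡ-+ c (c′ * φ (d ∙ d′)) _))

-- The product becomes an iterated sum over exponents, so its laws reduce to those of addition of
-- exponents.
pairing-⊗ : ∀ {k} (p q : Poly k) φ →
            pairing (p ⊗ q) φ ≡ pairing p (λ d → pairing q (λ d′ → φ (d ∙ d′)))
pairing-⊗ []            q φ = refl
pairing-⊗ ((c , d) ∷ p) q φ =
  trans (pairing-⊕ (map _ q) (p ⊗ q) φ) (cong₂ _+_ (pairing-map c d q φ) (pairing-⊗ p q φ))

∼-isEquivalence : ∀ {k} → IsEquivalence (_∼_ {k})
∼-isEquivalence = record
  { refl  = mk∼ λ φ → refl
  ; sym   = λ p∼q → mk∼ λ φ → sym (pairing-≡ p∼q φ)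
  ; trans = λ p∼q q∼r → mk∼ λ φ → trans (pairing-≡ p∼q φ) (pairing-≡ q∼r φ)
  }

module _ {k : ℕ} where
  open IsEquivalence (∼-isEquivalence {k}) public
    using () renaming (refl to ∼-refl; sym to ∼-sym; trans to ∼-trans; reflexive to ∼-reflexive)

⊕-cong : ∀ {k} {p p′ q q′ : Poly k} → p ∼ p′ → q ∼ q′ → p ⊕ q ∼ p′ ⊕ q′
⊕-cong {p = p} {p′} {q} {q′} p∼p′ q∼q′ = mk∼ λ φ →
  trans (pairing-⊕ p q φ) (trans (cong₂ _+_ (pairing-≡ p∼p′ φ) (pairing-≡ q∼q′ φ)) (sym (pairing-⊕ p′ q′ φ)))

⊗-cong : ∀ {k} {p p′ q q′ : Poly k} → p ∼ p′ → q ∼ q′ → p ⊗ q ∼ p′ ⊗ q′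
⊗-cong {p = p} {p′} {q} {q′} p∼p′ q∼q′ = mk∼ λ φ → begin
  pairing (p ⊗ q) φ                                     ≡⟨ pairing-⊗ p q φ ⟩
  pairing p (λ d → pairing q (λ d′ → φ (d ∙ d′)))       ≡⟨ pairing-≡ p∼p′ _ ⟩
  pairing p′ (λ d → pairing q (λ d′ → φ (d ∙ d′)))      ≡⟨ pairing-cong p′ (λ d → pairing-≡ q∼q′ _) ⟩
  pairing p′ (λ d → pairing q′ (λ d′ → φ (d ∙ d′)))     ≡⟨ pairing-⊗ p′ q′ φ ⟨
  pairing (p′ ⊗ q′) φ                                   ∎
  where open ≡-Reasoning

⊕-comm : ∀ {k} (p q : Poly k) → p ⊕ q ∼ q ⊕ p
⊕-comm p q = mk∼ λ φ → trans (pairing-⊕ p q φ) (trans (+-comm (pairing p φ) _) (sym (pairing-⊕ q p φ)))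

⊗-comm : ∀ {k} (p q : Poly k) → p ⊗ q ∼ q ⊗ p
⊗-comm p q = mk∼ λ φ → begin
  pairing (p ⊗ q) φ                                     ≡⟨ pairing-⊗ p q φ ⟩
  pairing p (λ d → pairing q (λ d′ → φ (d ∙ d′)))       ≡⟨ pairing-swap p q _ ⟩
  pairing q (λ d′ → pairing p (λ d → φ (d ∙ d′)))
    ≡⟨ pairing-cong q (λ d′ → pairing-cong p (λ d → cong φ (zipWith-comm +-comm d d′))) ⟩
  pairing q (λ d′ → pairing p (λ d → φ (d′ ∙ d)))       ≡⟨ pairing-⊗ q p φ ⟨
  pairing (q ⊗ p) φ                                     ∎
  where open ≡-Reasoning

⊗-assoc : ∀ {k} (p q r : Poly k) → (p ⊗ q) ⊗ r ∼ p ⊗ (q ⊗ r)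
⊗-assoc p q r = mk∼ λ φ → begin
  pairing ((p ⊗ q) ⊗ r) φ
    ≡⟨ pairing-⊗ (p ⊗ q) r φ ⟩
  pairing (p ⊗ q) (λ d → pairing r (λ d″ → φ (d ∙ d″)))
    ≡⟨ pairing-⊗ p q _ ⟩
  pairing p (λ d → pairing q (λ d′ → pairing r (λ d″ → φ ((d ∙ d′) ∙ d″))))
    ≡⟨ pairing-cong p (λ d → pairing-cong q (λ d′ → pairing-cong r (λ d″ →
         cong φ (zipWith-assoc +-assoc d d′ d″)))) ⟩
  pairing p (λ d → pairing q (λ d′ → pairing r (λ d″ → φ (d ∙ (d′ ∙ d″)))))
    ≡⟨ pairing-cong p (λ d → pairing-⊗ q r _) ⟨
  pairing p (λ d → pairing (q ⊗ r) (λ d′ → φ (d ∙ d′)))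
    ≡⟨ pairing-⊗ p (q ⊗ r) φ ⟨
  pairing (p ⊗ (q ⊗ r)) φ ∎
  where open ≡-Reasoning

⊗-distribʳ-⊕ : ∀ {k} (p q r : Poly k) → (q ⊕ r) ⊗ p ∼ (q ⊗ p) ⊕ (r ⊗ p)
⊗-distribʳ-⊕ p q r = mk∼ λ φ → begin
  pairing ((q ⊕ r) ⊗ p) φ                     ≡⟨ pairing-⊗ (q ⊕ r) p φ ⟩
  pairing (q ⊕ r) _                           ≡⟨ pairing-⊕ q r _ ⟩
  pairing q _ + pairing r _                   ≡⟨ cong₂ _+_ (pairing-⊗ q p φ) (pairing-⊗ r p φ) ⟨
  pairing (q ⊗ p) φ + pairing (r ⊗ p) φ       ≡⟨ pairing-⊕ (q ⊗ p) (r ⊗ p) φ ⟨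
  pairing ((q ⊗ p) ⊕ (r ⊗ p)) φ               ∎
  where open ≡-Reasoning

⊗-identityˡ : ∀ {k} (p : Poly k) → con 1 ⊗ p ∼ p
⊗-identityˡ p = mk∼ λ φ → begin
  pairing (con 1 ⊗ p) φ            ≡⟨ pairing-⊗ (con 1) p φ ⟩
  1 * pairing p _ + 0              ≡⟨ trans (+-identityʳ _) (*-identityˡ _) ⟩
  pairing p (λ d → φ (Vec.replicate _ 0 ∙ d))
    ≡⟨ pairing-cong p (λ d → cong φ (zipWith-identityˡ +-identityˡ d)) ⟩
  pairing p φ ∎
  where open ≡-Reasoning

polySemiring : ℕ → CommutativeSemiring _ _
polySemiring k = record
  { Carrier = Poly k
  ; _≈_     = _∼_
  ; _+_     = _⊕_
  ; _*_     = _⊗_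
  ; 0#      = []
  ; 1#      = con 1
  ; isCommutativeSemiring = IsCommutativeSemiringˡ.isCommutativeSemiring (record
    { +-isCommutativeMonoid = record
      { isMonoid = record
        { isSemigroup = record
          { isMagma = record { isEquivalence = ∼-isEquivalence ; ∙-cong = ⊕-cong }
          ; assoc   = λ p q r → mk∼ λ φ → cong (λ s → pairing s φ) (++-assoc p q r)
          }
        ; identity = (λ p → mk∼ λ φ → refl) , (λ p → ⊕-comm p [])
        }
      ; comm = ⊕-comm
      }
    ; *-isCommutativeMonoid = record
      { isMonoid = record
        { isSemigroup = record
          { isMagma = record { isEquivalence = ∼-isEquivalence ; ∙-cong = ⊗-cong }
          ; assoc   = ⊗-assoc
          }
        ; identity = ⊗-identityˡ , λ p → ∼-trans (⊗-comm p (con 1)) (⊗-identityˡ p)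
        }
      ; comm = ⊗-comm
      }
    ; distribʳ = ⊗-distribʳ-⊕
    ; zeroˡ    = λ p → mk∼ λ φ → refl
    })
  }

module _ {k : ℕ} where
  open CommutativeSemiring (polySemiring k) public using (setoid)
    renaming (+-congˡ to ⊕-congˡ; *-congˡ to ⊗-congˡ; distribˡ to ⊗-distribˡ-⊕
             ; zeroʳ to ⊗-zeroʳ; +-identityʳ to ⊕-identityʳ)
  open GeneratingSeries (polySemiring k) public

-- Identification of `h` with the generating series

when : ∀ {k} → Bool → Poly k → Poly k
when b p = if b then p else []

when-cong : ∀ {k} b {p q : Poly k} → p ∼ q → when b p ∼ when b q
when-cong true  p∼q = p∼q
when-cong false _   = ∼-refl

when-⊗ : ∀ {k} b (p q : Poly k) → when b (p ⊗ q) ∼ p ⊗ when b q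
when-⊗ true  p q = ∼-refl
when-⊗ false p q = ∼-sym (⊗-zeroʳ p)

module _ {k : ℕ} {A : Set} where

  ∑-cong : ∀ {f g : A → Poly k} → (∀ x → f x ∼ g x) → ∀ xs → ∑ (map f xs) ∼ ∑ (map g xs)
  ∑-cong f∼g []       = ∼-refl
  ∑-cong {f} {g} f∼g (x ∷ xs) = ⊕-cong (f∼g x) (∑-cong f∼g xs)

  ∑-++ : ∀ (f : A → Poly k) xs ys → ∑ (map f (xs ++ ys)) ≡ ∑ (map f xs) ⊕ ∑ (map f ys)
  ∑-++ f []       ys = refl
  ∑-++ f (x ∷ xs) ys = trans (cong (f x ⊕_) (∑-++ f xs ys)) (sym (++-assoc (f x) _ _))

  ∑-⊗ : ∀ p (f : A → Poly k) xs → ∑ (map (λ x → p ⊗ f x) xs) ∼ p ⊗ ∑ (map f xs)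
  ∑-⊗ p f []       = ∼-sym (⊗-zeroʳ p)
  ∑-⊗ p f (x ∷ xs) = ∼-trans (⊕-congˡ (∑-⊗ p f xs)) (∼-sym (⊗-distribˡ-⊕ p (f x) _))

  ∑-when : ∀ b (f : A → Poly k) xs → ∑ (map (λ x → when b (f x)) xs) ∼ when b (∑ (map f xs))
  ∑-when true  f xs       = ∼-refl
  ∑-when false f []       = ∼-refl
  ∑-when false f (x ∷ xs) = ∑-when false f xs

  -- Replaces the filter by a zero-or-one weight, so that the sum runs over all tuples and can be
  -- split by the first index.
  ∑-filter : ∀ {p} {P : Pred A p} (P? : Decidable P) (f : A → Poly k) xs →
             ∑ (map f (filter P? xs)) ≡ ∑ (map (λ x → when (does (P? x)) (f x)) xs)
  ∑-filter P? f []       = refl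
  ∑-filter P? f (x ∷ xs) with does (P? x)
  ... | true  = cong (f x ⊕_) (∑-filter P? f xs)
  ... | false = ∑-filter P? f xs

∑-cartesianProductWith : ∀ {k} {A B C : Set} (_∙_ : A → B → C) (f : C → Poly k) xs ys →
  ∑ (map f (cartesianProductWith _∙_ xs ys)) ≡ ∑ (map (λ x → ∑ (map (λ y → f (x ∙ y)) ys)) xs)
∑-cartesianProductWith _∙_ f []       ys = refl
∑-cartesianProductWith _∙_ f (x ∷ xs) ys =
  trans (∑-++ f (map (x ∙_) ys) _)
    (cong₂ _⊕_ (cong ∑ (sym (map-∘ ys))) (∑-cartesianProductWith _∙_ f xs ys))

∑-allFin-suc : ∀ {k m} (f : Fin (suc m) → Poly k) →
               ∑ (map f (allFin (suc m))) ≡ f zero ⊕ ∑ (map (f ∘ suc) (allFin m))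
∑-allFin-suc f = cong (λ ps → f zero ⊕ ∑ ps) (trans (map-tabulate suc f) (sym (map-tabulate id (f ∘ suc))))

-- The suffix of `tabulate x` starting at the given index: the variables still allowed after that
-- index in a weakly increasing tuple.
tabulateFrom : ∀ {A : Set} {m} → (Fin m → A) → Fin m → List A
tabulateFrom x zero    = tabulate x
tabulateFrom x (suc i) = tabulateFrom (x ∘ suc) i

-- Groups the monomials by their smallest index `j`; the other factors then use indices at least
-- `j`. This is the recursion of `complete` unrolled along the list.
complete-tabulate : ∀ {k m} (x : Fin m → Poly k) n →
  ∑ (map (λ j → x j ⊗ complete (tabulateFrom x j) n) (allFin m)) ∼ complete (tabulate x) (suc n)
complete-tabulate {m = zero}  x n = ∼-refl
complete-tabulate {k} {suc m} x n = begin
  ∑ (map (λ j → x j ⊗ complete (tabulateFrom x j) n) (allFin (suc m)))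
    ≡⟨ ∑-allFin-suc (λ j → x j ⊗ complete (tabulateFrom x j) n) ⟩
  (x zero ⊗ complete (tabulate x) n) ⊕ _
    ≈⟨ ⊕-congˡ (complete-tabulate (x ∘ suc) n) ⟩
  (x zero ⊗ complete (tabulate x) n) ⊕ complete (tabulate (x ∘ suc)) (suc n) ∎
  where open SetoidReasoning (setoid {k})

does-suc-≤? : ∀ {m} (i j : Fin m) → does (suc i Fin.≤? suc j) ≡ does (i Fin.≤? j)
does-suc-≤? i j = does-⇔ (mk⇔ ℕ.s≤s⁻¹ s≤s) (suc i Fin.≤? suc j) (i Fin.≤? j)

complete-tabulateFrom : ∀ {k m} (x : Fin m → Poly k) i n →
  ∑ (map (λ j → when (does (i Fin.≤? j)) (x j ⊗ complete (tabulateFrom x j) n)) (allFin m)) ∼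
  complete (tabulateFrom x i) (suc n)
complete-tabulateFrom x zero n = complete-tabulate x n
complete-tabulateFrom {k} {suc m} x (suc i) n = begin
  ∑ (map f (allFin (suc m)))
    ≡⟨ ∑-allFin-suc f ⟩
  ∑ (map (f ∘ suc) (allFin m))
    ≈⟨ ∑-cong (λ j → ∼-reflexive (cong (λ b → when b (x (suc j) ⊗ _)) (does-suc-≤? i j))) (allFin m) ⟩
  ∑ (map (λ j → when (does (i Fin.≤? j)) (x (suc j) ⊗ complete (tabulateFrom (x ∘ suc) j) n)) (allFin m))
    ≈⟨ complete-tabulateFrom (x ∘ suc) i n ⟩
  complete (tabulateFrom (x ∘ suc) i) (suc n) ∎
  where
  open SetoidReasoning (setoid {k})
  f : Fin (suc m) → Poly k
  f j = when (does (suc i Fin.≤? j)) (x j ⊗ complete (tabulateFrom x j) n)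

monomial : ∀ {k n} → Vec (Fin k) n → Poly k
monomial is = ∏ (Vec.map var is)

when-∧ : ∀ {k} a b (p : Poly k) → when (a ∧ b) p ≡ when a (when b p)
when-∧ true  b p = refl
when-∧ false b p = refl

-- Weakly increasing tuples that may follow `i` enumerate the monomials in the variables from `i`
-- on. Declared ahead of its proof for a mutual induction on the degree with `∑-linked-first`.
∑-linked-∷ : ∀ {k n} i → ∑ (map (λ is → when (does (linked? Fin._≤?_ (i ∷ is))) (monomial is)) (tuples k n)) ∼
                         complete (tabulateFrom var i) n

∑-linked-first : ∀ {k} n (j : Fin k) →
  ∑ (map (λ is → when (does (linked? Fin._≤?_ (j ∷ is))) (monomial (j ∷ is))) (tuples k n)) ∼
  var j ⊗ complete (tabulateFrom var j) n
∑-linked-first {k} n j = begin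
  ∑ (map (λ is → when (linked is) (var j ⊗ monomial is)) (tuples k n))
    ≈⟨ ∑-cong (λ is → when-⊗ (linked is) (var j) (monomial is)) (tuples k n) ⟩
  ∑ (map (λ is → var j ⊗ when (linked is) (monomial is)) (tuples k n))
    ≈⟨ ∑-⊗ (var j) _ (tuples k n) ⟩
  var j ⊗ ∑ (map (λ is → when (linked is) (monomial is)) (tuples k n))
    ≈⟨ ⊗-congˡ {x = var j} (∑-linked-∷ {n = n} j) ⟩
  var j ⊗ complete (tabulateFrom var j) n ∎
  where
  open SetoidReasoning (setoid {k})
  linked : Vec (Fin k) n → Bool
  linked is = does (linked? Fin._≤?_ (j ∷ is))

-- `complete` at 0 is 1 for every list, but reduces only when the shape of the list is known.
∑-linked-∷ {k} {zero} i with tabulateFrom (var {k}) i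
... | []    = ∼-refl
... | _ ∷ _ = ∼-refl
∑-linked-∷ {k} {suc n} i = begin
  ∑ (map (λ is → when (does (linked? Fin._≤?_ (i ∷ is))) (monomial is)) (tuples k (suc n)))
    ≡⟨ ∑-cartesianProductWith _∷_ _ (allFin k) (tuples k n) ⟩
  -- The decision for `i ∷ j ∷ is` computes to this conjunction.
  ∑ (map (λ j → ∑ (map (λ is → when (does (i Fin.≤? j) ∧ linked j is) (monomial (j ∷ is))) (tuples k n))) (allFin k))
    ≈⟨ ∑-cong (λ j → ∼-trans
         (∑-cong (λ is → ∼-reflexive (when-∧ (does (i Fin.≤? j)) (linked j is) (monomial (j ∷ is)))) (tuples k n))
         (∼-trans (∑-when (does (i Fin.≤? j)) (λ is → when (linked j is) (monomial (j ∷ is))) (tuples k n))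
                  (when-cong (does (i Fin.≤? j)) (∑-linked-first n j)))) (allFin k) ⟩
  ∑ (map (λ j → when (does (i Fin.≤? j)) (var j ⊗ complete (tabulateFrom var j) n)) (allFin k))
    ≈⟨ complete-tabulateFrom var i n ⟩
  complete (tabulateFrom var i) (suc n) ∎
  where
  open SetoidReasoning (setoid {k})
  linked : Fin k → Vec (Fin k) n → Bool
  linked j is = does (linked? Fin._≤?_ (j ∷ is))

-- In positive degree a tuple has a first index, and that index is unconstrained.
h-suc∼complete : ∀ k n → h (suc n) k ∼ complete (tabulate var) (suc n)
h-suc∼complete k n = begin
  h (suc n) k
    ≡⟨ ∑-filter (linked? Fin._≤?_) monomial (tuples k (suc n)) ⟩
  ∑ (map (λ is → when (does (linked? Fin._≤?_ is)) (monomial is)) (tuples k (suc n)))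
    ≡⟨ ∑-cartesianProductWith _∷_ _ (allFin k) (tuples k n) ⟩
  ∑ (map (λ j → ∑ (map (λ is → when (does (linked? Fin._≤?_ (j ∷ is))) (monomial (j ∷ is))) (tuples k n))) (allFin k))
    ≈⟨ ∑-cong (∑-linked-first n) (allFin k) ⟩
  ∑ (map (λ j → var j ⊗ complete (tabulateFrom var j) n) (allFin k))
    ≈⟨ complete-tabulate var n ⟩
  complete (tabulate var) (suc n) ∎
  where open SetoidReasoning (setoid {k})

-- Circuit construction within a gate budget

halve-< : ∀ {n m} → n < m + m → ⌊ n /2⌋ < m
halve-< {n} {m} n<m+m = ≰⇒> λ m≤half → <⇒≱ n<m+m (begin
  m + m              ≤⟨ +-mono-≤ m≤half (≤-trans m≤half (⌊n/2⌋≤⌈n/2⌉ n)) ⟩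
  ⌊ n /2⌋ + ⌈ n /2⌉  ≡⟨ ⌊n/2⌋+⌈n/2⌉≡n n ⟩
  n                  ∎)
  where open ≤-Reasoning

-- One halving step with `l` variables: `l` squarings, then `l` multiplications by a factor
-- `1 + xt`, each charged two gates for each of `l + l` entries.
levelCost : ℕ → ℕ
levelCost l = l + l * ((l + l) * 2)

module _ {k : ℕ} where

  Program : Set
  Program = ∃[ s ] Gates k s

  weaken : ∀ {m} → Source k m → Source k (suc m)
  weaken (input i)  = input i
  weaken (scalar c) = scalar c
  weaken (gate j)   = gate (suc j)

  ⟦weaken⟧ : ∀ {m} (s : Source k m) {p} {vs : Vec (Poly k) m} → ⟦ weaken s ⟧source (p ∷ vs) ≡ ⟦ s ⟧source vs
  ⟦weaken⟧ (input i)  = refl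
  ⟦weaken⟧ (scalar c) = refl
  ⟦weaken⟧ (gate j)   = refl

  -- Zero counts as available because no circuit computes it, scalars being positive.
  Available : Program → Poly k → Set
  Available (s , gs) p = p ∼ [] ⊎ Σ[ src ∈ Source k s ] ⟦ src ⟧source ⟦ gs ⟧gates ∼ p

  available-resp-∼ : ∀ {G p q} → p ∼ q → Available G p → Available G q
  available-resp-∼ p∼q (inj₁ p∼0)       = inj₁ (∼-trans (∼-sym p∼q) p∼0)
  available-resp-∼ p∼q (inj₂ (src , e)) = inj₂ (src , ∼-trans e p∼q)

  infix 4 _⊑_
  _⊑_ : Program → Program → Set
  G ⊑ G′ = ∀ {p} → Available G p → Available G′ p

  -- Growth by at most `t` gates. Since placing a gate renumbers the earlier ones, results are
  -- described by availability in the new program rather than by fixed sources.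
  record Extension (G : Program) (t : ℕ) (P : Program → Set) : Set where
    constructor extension
    field
      program : Program
      size≤   : proj₁ program ≤ proj₁ G + t
      keeps   : G ⊑ program
      reaches : P program

  module _ {G : Program} where

    stay : ∀ {P : Program → Set} → P G → Extension G 0 P
    stay p = extension G (≤-reflexive (sym (+-identityʳ _))) id p

    relax : ∀ {t t′ P} → t ≤ t′ → Extension G t P → Extension G t′ P
    relax t≤t′ (extension G′ size≤ keeps p) = extension G′ (≤-trans size≤ (+-monoʳ-≤ _ t≤t′)) keeps p

    infixl 1 _>>=_
    _>>=_ : ∀ {t t′ P Q} → Extension G t P →
            (∀ {G′} → G ⊑ G′ × P G′ → Extension G′ t′ Q) → Extension G (t + t′) Q
    _>>=_ {t} {t′} (extension G′ size≤ keeps p) f with f {G′} ((λ {q} → keeps {q}) , p)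
    ... | extension G″ size≤′ keeps′ q =
      extension G″ (≤-trans size≤′ (≤-trans (+-monoˡ-≤ t′ size≤) (≤-reflexive (+-assoc _ t t′)))) (keeps′ ∘ keeps) q

    infixl 1 _<&>_
    _<&>_ : ∀ {t P Q} → Extension G t P → (∀ {G′} → G ⊑ G′ × P G′ → Q G′) → Extension G t Q
    extension G′ size≤ keeps p <&> f = extension G′ size≤ keeps (f ((λ {q} → keeps {q}) , p))

    place : ∀ o (l r : Source k (proj₁ G)) → let vs = ⟦ proj₂ G ⟧gates in
            Extension G 1 (λ G′ → Available G′ (⟦ o ⟧op (⟦ l ⟧source vs) (⟦ r ⟧source vs)))
    place o l r = extension (_ , proj₂ G ▷ mkGate o l r) (≤-reflexive (+-comm 1 _)) keeps (inj₂ (gate zero , ∼-refl))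
      where
      keeps : G ⊑ (_ , proj₂ G ▷ mkGate o l r)
      keeps (inj₁ p∼0)       = inj₁ p∼0
      keeps (inj₂ (src , e)) = inj₂ (weaken src , ∼-trans (∼-reflexive (⟦weaken⟧ src)) e)

    -- A zero summand costs no gate, as the sum is then the other summand; two proper sources cost
    -- one.
    place-⊕ : ∀ {p q} → Available G p → Available G q → Extension G 1 (λ G′ → Available G′ (p ⊕ q))
    place-⊕ (inj₁ p∼0) q = relax z≤n (stay (available-resp-∼ {G} (⊕-cong (∼-sym p∼0) ∼-refl) q))
    place-⊕ {p} (inj₂ a) (inj₁ q∼0) =
      relax z≤n (stay (available-resp-∼ {G} (∼-trans (∼-sym (⊕-identityʳ p)) (⊕-congˡ (∼-sym q∼0))) (inj₂ a)))
    place-⊕ (inj₂ (l , l∼p)) (inj₂ (r , r∼q)) = place add l r <&> λ {G′} (_ , a) → available-resp-∼ {G′} (⊕-cong l∼p r∼q) a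

    place-⊗ : ∀ {p q} → Available G p → Available G q → Extension G 1 (λ G′ → Available G′ (p ⊗ q))
    place-⊗ (inj₁ p∼0) q = relax z≤n (stay (inj₁ (⊗-cong p∼0 ∼-refl)))
    place-⊗ {p} (inj₂ _) (inj₁ q∼0) = relax z≤n (stay (inj₁ (∼-trans (⊗-congˡ {x = p} q∼0) (⊗-zeroʳ p))))
    place-⊗ (inj₂ (l , l∼p)) (inj₂ (r , r∼q)) = place mul l r <&> λ {G′} (_ , a) → available-resp-∼ {G′} (⊗-cong l∼p r∼q) a

  Window : Program → ℕ → Series → Set
  Window G m f = ∀ i → i < m → Available G (f i)

  -- Entries run downwards in degree, so multiplying by `1 + xt` adds `x` times the next entry: one
  -- product and one sum each. The last entry has no successor, hence the loss of one.
  place-linear : ∀ {G} m x f → Available G x → Window G (suc m) f →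
                 Extension G (m * 2) (λ G′ → Window G′ m (λ i → f i ⊕ (x ⊗ f (suc i))))
  place-linear zero x f x✓ f✓ = stay (λ _ ())
  place-linear {G} (suc m) x f x✓ f✓ =
    place-⊗ x✓ (f✓ 1 (s<s z<s)) >>= λ (keeps₁ , xf₁) →
    place-⊕ (keeps₁ (f✓ 0 z<s)) xf₁ >>= λ (keeps₂ , head) →
    place-linear m x (f ∘ suc) (keeps₂ (keeps₁ x✓)) (λ i i<m → keeps₂ (keeps₁ (f✓ (suc i) (s<s i<m)))) <&> λ (keeps₃ , tail) →
    λ { zero _ → keeps₃ head ; (suc i) (s≤s i<m) → tail i i<m }

  place-linears : ∀ {G} m N xs f → All (Available G) xs → Window G (length xs + m) (λ i → below f i N) →
                  Extension G (length xs * ((length xs + m) * 2)) (λ G′ → Window G′ m (λ i → below (linears xs f) i N))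
  place-linears m N []       f []         f✓ = stay f✓
  place-linears m N (x ∷ xs) f (x✓ ∷ xs✓) f✓ = relax cost≤
    (place-linear (length xs + m) x (λ i → below f i N) x✓ f✓ >>= λ {G′} (keeps , w) →
     place-linears m N xs (linear x f) (All.map keeps xs✓)
       (λ i i< → available-resp-∼ {G′} (∼-sym (below-linear x f i N)) (w i i<)))
    where
    -- Every factor is charged at the width of the initial, widest window.
    cost≤ : (length xs + m) * 2 + length xs * ((length xs + m) * 2) ≤ suc (length xs) * (suc (length xs + m) * 2)
    cost≤ = *-monoʳ-≤ (suc (length xs)) (*-monoˡ-≤ 2 (n≤1+n (length xs + m)))

  place-squares : ∀ {G} xs → All (Available G) xs →
                  Extension G (length xs) (λ G′ → All (Available G′) (map square xs))
  place-squares []       []         = stay []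
  place-squares (x ∷ xs) (x✓ ∷ xs✓) =
    place-⊗ x✓ x✓ >>= λ (keeps₁ , x²✓) →
    place-squares xs (All.map keeps₁ xs✓) <&> λ (keeps₂ , xs²✓) →
    keeps₂ x²✓ ∷ xs²✓

  -- Induction on `L`: halving `N` preserves the bound by a power of two, and the variables are
  -- replaced by their squares.
  place-complete : ∀ {G} L N xs → N < 2 ^ L → All (Available G) xs →
                   Extension G (L * levelCost (length xs)) (λ G′ → Window G′ (length xs) (λ i → below (complete xs) i N))
  place-complete {G} zero zero xs N< xs✓ = stay λ where
    zero    _ → inj₂ (scalar 1 , ∼-sym (complete-zero xs))
    (suc i) _ → inj₁ ∼-refl
  place-complete zero    (suc N) xs (s≤s ()) xs✓
  place-complete (suc L) N xs N< xs✓ = relax (≤-reflexive cost≡)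
    (place-squares xs xs✓ >>= λ (keeps₁ , xs²✓) →
     place-complete L ⌊ N /2⌋ xs² (halve-< (subst (N <_) (cong (2 ^ L +_) (+-identityʳ (2 ^ L))) N<)) xs²✓ >>= λ {G′} (keeps₂ , w) →
     -- Interleaving gives `l + l` entries, and the `l` factors use up one each, leaving the `l`
     -- required.
     place-linears l N xs (spread (complete xs²)) (All.map (keeps₂ ∘ keeps₁) xs✓) (interleave G′ w) <&> λ {G″} (_ , w′) →
     λ i i<l → available-resp-∼ {G″} (below-cong (λ n → ∼-sym (complete-doubling xs n)) i N) (w′ i i<l))
    where
    l : ℕ
    l = length xs
    xs² : List (Poly k)
    xs² = map square xs

    interleave : ∀ G → Window G (length xs²) (λ i → below (complete xs²) i ⌊ N /2⌋) →
                 Window G (l + l) (λ i → below (spread (complete xs²)) i N)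
    interleave G w i i<l+l with below-spread (complete xs²) i N
    ... | inj₁ eq = inj₁ (∼-reflexive eq)
    ... | inj₂ eq = subst (Available G) (sym eq) (w ⌊ i /2⌋ (subst (⌊ i /2⌋ <_) (sym (length-map square xs)) (halve-< i<l+l)))

    cost≡ : l + (L * levelCost (length xs²) + l * ((l + l) * 2)) ≡ suc L * levelCost l
    cost≡ rewrite length-map square xs =
      trans (cong (l +_) (+-comm (L * levelCost l) _)) (sym (+-assoc l _ _))

-- Nonvanishing and the final gate count

-- Evaluation with every variable set to 1 gives a positive number. This excludes the case in which
-- availability means being zero and supplies no output source.
complete-∷-≁0 : ∀ {k} (i : Fin k) xs n → ¬ complete (var i ∷ xs) n ∼ []
complete-∷-≁0 i xs n eq = <⇒≢ (positive n) (sym (pairing-≡ eq one))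
  where
  one = λ _ → 1
  positive : ∀ n → 0 < pairing (complete (var i ∷ xs) n) one
  positive zero    = z<s
  positive (suc n) = begin-strict
    0                                                                <⟨ positive n ⟩
    pairing (complete (var i ∷ xs) n) one                            ≡⟨ trans (+-identityʳ _) (*-identityˡ _) ⟨
    pairing (var i) (λ _ → pairing (complete (var i ∷ xs) n) one)    ≡⟨ pairing-⊗ (var i) (complete (var i ∷ xs) n) one ⟨
    pairing (var i ⊗ complete (var i ∷ xs) n) one                    ≤⟨ m≤m+n _ _ ⟩
    pairing (var i ⊗ complete (var i ∷ xs) n) one + pairing (complete xs (suc n)) one
      ≡⟨ pairing-⊕ (var i ⊗ complete (var i ∷ xs) n) (complete xs (suc n)) one ⟨
    pairing (complete (var i ∷ xs) (suc n)) one ∎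
    where open ≤-Reasoning

n<2^[1+⌊log₂n⌋] : ∀ n → n < 2 ^ suc ⌊log₂ n ⌋
n<2^[1+⌊log₂n⌋] n = ≰⇒> λ 2^≤n →
  1+n≰n (subst (_≤ ⌊log₂ n ⌋) (⌊log₂[2^n]⌋≡n (suc ⌊log₂ n ⌋)) (⌊log₂⌋-mono-≤ 2^≤n))

-- The constant is `10 = 2 · 5`: `suc l ≤ l + l` because `1 ≤ l`, and `levelCost k ≤ k² + 4k²`.
total-cost≤ : ∀ k l → 1 ≤ k → 1 ≤ l → suc l * levelCost k ≤ 10 * k ^ 2 * l
total-cost≤ k@(suc _) l 1≤k 1≤l = begin
  suc l * levelCost k             ≤⟨ *-mono-≤ (+-monoˡ-≤ l 1≤l) (+-monoˡ-≤ _ (m≤m*n k k)) ⟩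
  (l + l) * (k * k + k * ((k + k) * 2))   ≡⟨ expand k l ⟩
  10 * k ^ 2 * l                  ∎
  where
  open ≤-Reasoning
  expand : ∀ k l → (l + l) * (k * k + k * ((k + k) * 2)) ≡ 10 * (k * (k * 1)) * l
  expand = solve-∀

theorem1p4 : ∃[ C ] (0 < C × (∀ (k n : ℕ) → 1 ≤ k → 2 ≤ n →
    SemiringComplexity≤ (h n k) (C * k ^ 2 * ⌊log₂ n ⌋)))
theorem1p4 = 10 , z<s , bound
  where
  bound : ∀ k n → 1 ≤ k → 2 ≤ n → SemiringComplexity≤ (h n k) (10 * k ^ 2 * ⌊log₂ n ⌋)
  bound k@(suc _) n@(suc n′) 1≤k 2≤n = read-off
    (place-complete (suc L) n xs (n<2^[1+⌊log₂n⌋] n) (tabulate⁺ (λ i → inj₂ (input i , ∼-refl))))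
    where
    L : ℕ
    L = ⌊log₂ n ⌋
    xs : List (Poly k)
    xs = tabulate var

    cost≤ : suc L * levelCost (length xs) ≤ 10 * k ^ 2 * L
    cost≤ = subst (λ l → suc L * levelCost l ≤ 10 * k ^ 2 * L) (sym (length-tabulate (var {k})))
      (total-cost≤ k L 1≤k (⌊log₂⌋-mono-≤ 2≤n))

    read-off : Extension (0 , []) (suc L * levelCost (length xs))
                 (λ G → Window G (length xs) (λ i → below (complete xs) i n)) →
               SemiringComplexity≤ (h n k) (10 * k ^ 2 * L)
    -- Entry 0 of the window is the coefficient of index `n` itself; it exists because there is at
    -- least one variable.
    read-off (extension (s , gs) s≤ _ w) with w 0 z<s
    ... | inj₁ h∼0       = ⊥-elim (complete-∷-≁0 zero _ n h∼0)
    ... | inj₂ (src , e) =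
      s , ≤-trans s≤ cost≤ , mkCircuit gs src , ∼⇒≈ (∼-trans e (∼-sym (h-suc∼complete k n′)))
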